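{- The Zimin word $Z$ admits no suffix having a super-monochromatic factorisation with respect to the coloring $C$ of $\mathcal{A}_x^+$ described in the context.
   Context: Alphabet $\mathcal{A}_x=\{x_1,x_2,\ldots\}$; $Z_1=x_1$, $Z_{m+1}=Z_mx_{m+1}Z_m$, $Z=\lim Z_m=x_1x_2x_1x_3x_1x_2x_1x_4\ldots$. For a factor $u$ of $Z$ (nonempty finite word occurring in $Z$), $k(u)=\max\{k:x_k\text{ occurs in }u\}$. $u_1=v_1=x_1$, $u_{m+1}=x_{m+1}u_1\cdots u_m$, $v_{m+1}=v_m\cdots v_1x_{m+1}$; $[a,b[=\{a,\ldots,b-1\}$; for finite $A=\{i_1<\cdots<i_k\}$, $u_A=u_{i_1}\cdots u_{i_k}$ and for $B=\{j_1<\cdots<j_k\}$, $v_B=v_{j_k}\cdots v_{j_1}$ (empty products are empty). Every factor $u$ of $Z$ is uniquely $u=u_Ax_{k(u)}v_B$ with $A,B\subset[1,k(u)[$; set $\eta(u)=\max([1,k(u)[\setminus A)$, or $\eta(u)=0$ if $A=[1,k(u)[$. The coloring $C$: for a factor $u$ of $Z$, $C(u)=\textbf{red}$ if $A\cap[1,\eta(u)[=[1,\eta(u)[\setminus(B\cap[1,\eta(u)[)$ and $C(u)=\textbf{blue}$ otherwise; for a non-factor $u$ of $Z$, $C(u)=\textbf{red}$ if every decomposition of $u$ as a concatenation of factors of $Z$ has at least three terms, and $C(u)=\textbf{blue}$ if $u$ is a concatenation of two factors of $Z$. A factorisation $y=w_1w_2\ldots$ (nonempty finite $w_i$) is super-monochromatic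 if $C$ is constant on $\{w_{n_1}\cdots w_{n_k}: k\geq1, n_1<\cdots<n_k\}$. A suffix of $Z=z_0z_1\ldots$ is $z_kz_{k+1}\ldots$, $k\geq0$. -}

module Defs where

open import Data.Nat using (ℕ; zero; suc; _+_; _⊔_; _≤_; _<_)
open import Data.Bool using (Bool; true; false; if_then_else_; not)
open import Data.List using (List; []; _∷_; _++_; map; upTo; length; foldr)
open import Data.List.Membership.Propositional using (_∈_)
open import Data.Product using (Σ; ∃; ∃₂; _×_)
open import Data.Sum using (_⊎_)
open import Relation.Nullary using (¬_)
open import Relation.Binary.PropositionalEquality using (_≡_; _≢_)

-- Words over the alphabet A_x = {x_1, x_2, ...}: the letter x_k is encoded
-- by the natural number k (k ≥ 1); a word is a List ℕ.

Zfin : ℕ → List ℕ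
Zfin zero    = []
Zfin (suc m) = Zfin m ++ (suc m ∷ Zfin m)

-- n-th letter of a list (0-based), default 0 (never used out of range below).
nth : List ℕ → ℕ → ℕ
nth []       _       = 0
nth (a ∷ as) zero    = a
nth (a ∷ as) (suc i) = nth as i

-- The infinite Zimin word Z = z_0 z_1 z_2 ... = lim Z_m.
-- Zfin (i+1) has length 2^(i+1) - 1 > i and is a prefix of every later Zfin m.
z : ℕ → ℕ
z i = nth (Zfin (suc i)) i

seg : ℕ → ℕ → List ℕ
seg i n = map (λ j → z (i + j)) (upTo n)

IsFactor : List ℕ → Set
IsFactor u = (u ≢ []) × ∃ λ i → u ≡ seg i (length u)

TwoFactors : List ℕ → Set
TwoFactors u = ∃₂ λ a b → IsFactor a × IsFactor b × (u ≡ a ++ b)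

kmax : List ℕ → ℕ
kmax = foldr _⊔_ 0

-- The words u_m (m ≥ 1) and the products uPre m = u_1 ⋯ u_m:
-- u_1 = x_1, u_{m+1} = x_{m+1} u_1 ⋯ u_m.  (uw 0 = [] is a dummy value.)
mutual
  uw : ℕ → List ℕ
  uw zero    = []
  uw (suc m) = suc m ∷ uPre m

  uPre : ℕ → List ℕ
  uPre zero    = []
  uPre (suc m) = uPre m ++ uw (suc m)

-- The words v_m (m ≥ 1) and vPre m = v_m ⋯ v_1:
-- v_1 = x_1, v_{m+1} = v_m ⋯ v_1 x_{m+1}.  (vw 0 = [] is a dummy value.)
mutual
  vw : ℕ → List ℕ
  vw zero    = []
  vw (suc m) = vPre m ++ (suc m ∷ [])

  vPre : ℕ → List ℕ
  vPre zero    = []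
  vPre (suc m) = vw (suc m) ++ vPre m

-- Subsets of ℕ are given by characteristic functions ℕ → Bool; only their
-- values on [1, k[ matter below.
-- uSel A n = u_A for A ∩ [1,n[ (increasing order of indices).
uSel : (ℕ → Bool) → ℕ → List ℕ
uSel A zero    = []
uSel A (suc n) = uSel A n ++ (if A n then uw n else [])

vSel : (ℕ → Bool) → ℕ → List ℕ
vSel B zero    = []
vSel B (suc n) = (if B n then vw n else []) ++ vSel B n

eta : (ℕ → Bool) → ℕ → ℕ
eta A zero          = 0
eta A (suc zero)    = 0
eta A (suc (suc m)) = if A (suc m) then eta A (suc m) else suc m

FactorRed : List ℕ → Set
FactorRed u =
  Σ (ℕ → Bool) λ A → Σ (ℕ → Bool) λ B →
    (u ≡ uSel A (kmax u) ++ (kmax u ∷ vSel B (kmax u))) ×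
    (∀ i → 1 ≤ i → i < eta A (kmax u) → A i ≡ not (B i))

data Color : Set where
  red blue : Color

HasColor : List ℕ → Color → Set
HasColor u red  = (IsFactor u × FactorRed u) ⊎ ((¬ IsFactor u) × (¬ TwoFactors u))
HasColor u blue = (IsFactor u × (¬ FactorRed u)) ⊎ ((¬ IsFactor u) × TwoFactors u)

prefixConcat : (ℕ → List ℕ) → ℕ → List ℕ
prefixConcat w zero    = []
prefixConcat w (suc n) = prefixConcat w n ++ w n

-- For bs = b_0 … b_{N-1}, subProd w bs = product of the w_i (i < N, b_i = true)
-- in increasing order of i; a nonempty such selection is w_{n_1} ⋯ w_{n_k}.
subProdFrom : (ℕ → List ℕ) → ℕ → List Bool → List ℕ
subProdFrom w i []       = []
subProdFrom w i (b ∷ bs) = (if b then w i else []) ++ subProdFrom w (suc i) bs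

subProd : (ℕ → List ℕ) → List Bool → List ℕ
subProd w = subProdFrom w 0

IsFactorisationOfSuffix : ℕ → (ℕ → List ℕ) → Set
IsFactorisationOfSuffix k w =
  (∀ n → w n ≢ []) ×
  (∀ n → prefixConcat w n ≡ seg k (length (prefixConcat w n)))

SuperMonochromatic : (ℕ → List ℕ) → Set
SuperMonochromatic w = Σ Color λ c → ∀ bs → true ∈ bs → HasColor (subProd w bs) c

{-# OPTIONS --safe #-}
module Submission where

-- The letter z_i of Z is one more than the 2-adic valuation of i + 1.  Let a factor of Z start right after
-- position a and end at position b (positions counted from 1), and suppose that a power of two lies in ]a, b].
-- If 2^e ≤ a < 2^(e+1), the factor is red exactly when 2^e divides b - a.
--
-- Merge consecutive terms of a factorisation until a power of two 2^(e_{i+1}) separates any two successive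
-- cut positions b_i < b_{i+1}, where 2^(e_i) ≤ b_i < 2^(e_i + 1), and let W_i be the word between them.
-- Looking at the letters carried by 2^(e_1) and 2^(e_3), the word W_0 W_2 can only be a factor
-- if 2^(e_1 + 1) divides b_2 - b_1.
--
-- Red: W_0 W_2 is a factor, since a non-factor made of two factors is blue.  As W_0 W_2 and W_2 are both red,
-- 2^(e_2) divides their lengths, hence also b_1 - b_0, which is positive and less than 2^(e_2).
--
-- Blue: W_1 and W_3 are not red, so no factor contains W_0 together with the part of W_2 up to 2^(e_3), nor the
-- part of W_2 from 2^(e_3) on together with W_4.  Hence W_0 W_2 W_4 is not a product of at most two factors,
-- and is red.

open import Defs
open import Data.Bool using (Bool; true; false; if_then_else_; not)
open import Data.Bool.Properties using (not-involutive)
open import Data.List using (List; []; _∷_; _++_; length; map; upTo; applyUpTo)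
open import Data.List.Properties using (length-++; ++-assoc; ++-identityʳ; ++-conicalˡ; ∷-injective; ∷-injectiveˡ; ∷-injectiveʳ; length-map; length-upTo)
open import Data.List.Membership.Propositional using (_∈_)
open import Data.List.Relation.Unary.All as All using (All; []; _∷_)
open import Data.List.Relation.Unary.All.Properties using (++⁺)
open import Data.List.Relation.Unary.Any using (here; there)
open import Data.Nat
open import Data.Nat.DivMod
open import Data.Nat.Divisibility
open import Data.Nat.Properties
open import Data.Nat.Solver using (module +-*-Solver)
open import Data.Product using (∃; ∃₂; _×_; _,_; proj₁; proj₂)
open import Data.Sum using (_⊎_; inj₁; inj₂)
open import Function using (_∘_)
open import Relation.Binary.Definitions using (tri<; tri≈; tri>)
open import Relation.Binary.PropositionalEquality
open import Relation.Nullary using (¬_; yes; no; contradiction)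

-- Powers of two and binary orders

2^-suc : ∀ m → 2 ^ suc m ≡ 2 ^ m + 2 ^ m
2^-suc m = cong (2 ^ m +_) (+-identityʳ (2 ^ m))

2^-mono : ∀ {m n} → m ≤ n → 2 ^ m ≤ 2 ^ n
2^-mono = ^-monoʳ-≤ 2

2^-cancel-< : ∀ {m n} → 2 ^ m < 2 ^ n → m < n
2^-cancel-< {m} {n} p with m <? n
... | yes m<n = m<n
... | no m≮n = contradiction (2^-mono (≮⇒≥ m≮n)) (<⇒≱ p)

2^-∣ : ∀ {m n} → m ≤ n → 2 ^ m ∣ 2 ^ n
2^-∣ {m} {n} m≤n = divides (2 ^ (n ∸ m)) (begin
  2 ^ n ≡⟨ cong (2 ^_) (sym (m∸n+n≡m m≤n)) ⟩
  2 ^ (n ∸ m + m) ≡⟨ ^-distribˡ-+-* 2 (n ∸ m) m ⟩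
  2 ^ (n ∸ m) * 2 ^ m ∎)
  where open ≡-Reasoning

n<2^n : ∀ n → n < 2 ^ n
n<2^n zero = s≤s z≤n
n<2^n (suc n) = subst (suc n <_) (sym (2^-suc n)) (+-mono-≤-< (m^n>0 2 n) (n<2^n n))

suc-pred-2^ : ∀ m → suc (pred (2 ^ m)) ≡ 2 ^ m
suc-pred-2^ m = suc-pred (2 ^ m) {{m^n≢0 2 m}}

binary-order : ∀ n → 1 ≤ n → ∃ λ e → 2 ^ e ≤ n × n < 2 ^ suc e
binary-order (suc zero) _ = 0 , ≤-refl , ≤-refl
binary-order (suc (suc n)) _ with binary-order (suc n) (s≤s z≤n)
... | e , lo , hi with suc (suc n) <? 2 ^ suc e
... | yes p = e , m≤n⇒m≤1+n lo , p
... | no p = suc e , ≮⇒≥ p , ≤-<-trans hi (subst (2 ^ suc e <_) (sym (2^-suc (suc e)))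
    (m<m+n (2 ^ suc e) (m^n>0 2 (suc e))))

-- The letters of Z

length-Zfin : ∀ m → suc (length (Zfin m)) ≡ 2 ^ m
length-Zfin zero = refl
length-Zfin (suc m) = begin
  suc (length (Zfin m ++ suc m ∷ Zfin m)) ≡⟨ cong suc (length-++ (Zfin m)) ⟩
  suc (length (Zfin m)) + suc (length (Zfin m)) ≡⟨ cong₂ _+_ (length-Zfin m) (length-Zfin m) ⟩
  2 ^ m + 2 ^ m ≡⟨ sym (2^-suc m) ⟩
  2 ^ suc m ∎
  where open ≡-Reasoning

nth-++ˡ : ∀ xs {ys i} → i < length xs → nth (xs ++ ys) i ≡ nth xs i
nth-++ˡ (x ∷ xs) {i = zero} _ = refl
nth-++ˡ (x ∷ xs) {i = suc i} (s≤s p) = nth-++ˡ xs p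

nth-++ʳ : ∀ xs {ys} i → nth (xs ++ ys) (length xs + i) ≡ nth ys i
nth-++ʳ [] i = refl
nth-++ʳ (x ∷ xs) i = nth-++ʳ xs i

nth-Zfin-mono : ∀ {m n i} → m ≤ n → suc i < 2 ^ m → nth (Zfin n) i ≡ nth (Zfin m) i
nth-Zfin-mono {m} {i = i} m≤n p = go (≤⇒≤′ m≤n)
  where
  go : ∀ {n} → m ≤′ n → nth (Zfin n) i ≡ nth (Zfin m) i
  go ≤′-refl = refl
  go (≤′-step {n} q) = trans (nth-++ˡ (Zfin n) (≤-pred (subst (suc i <_) (sym (length-Zfin n))
    (≤-trans p (2^-mono (≤′⇒≤ q)))))) (go q)

-- Frees `z i` from the particular prefix `Zfin (suc i)` of its definition. Indices start at 0, so
-- index `i` is position `suc i`, and `Zfin m` covers the positions below `2 ^ m`.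
z-nth : ∀ m {i} → suc i < 2 ^ m → z i ≡ nth (Zfin m) i
z-nth m {i} p with ≤-total m (suc i)
... | inj₁ q = nth-Zfin-mono q p
... | inj₂ q = sym (nth-Zfin-mono q (n<2^n (suc i)))

z-2^ : ∀ m → z (pred (2 ^ m)) ≡ suc m
z-2^ m = begin
  z (pred (2 ^ m)) ≡⟨ z-nth (suc m) lt ⟩
  nth (Zfin (suc m)) (pred (2 ^ m)) ≡⟨ cong (nth (Zfin (suc m))) eq ⟩
  nth (Zfin m ++ suc m ∷ Zfin m) (length (Zfin m) + 0) ≡⟨ nth-++ʳ (Zfin m) 0 ⟩
  suc m ∎
  where
  open ≡-Reasoning
  eq : pred (2 ^ m) ≡ length (Zfin m) + 0
  eq = trans (cong pred (sym (length-Zfin m))) (sym (+-identityʳ _))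
  lt : suc (pred (2 ^ m)) < 2 ^ suc m
  lt = subst₂ _<_ (sym (suc-pred-2^ m)) (sym (2^-suc m)) (m<m+n (2 ^ m) (m^n>0 2 m))

z-shift : ∀ m {i} → suc i < 2 ^ m → z (2 ^ m + i) ≡ z i
z-shift m {i} p = begin
  z (2 ^ m + i) ≡⟨ z-nth (suc m) lt ⟩
  nth (Zfin (suc m)) (2 ^ m + i) ≡⟨ cong (nth (Zfin (suc m))) eq ⟩
  nth (Zfin m ++ suc m ∷ Zfin m) (length (Zfin m) + suc i) ≡⟨ nth-++ʳ (Zfin m) (suc i) ⟩
  nth (Zfin m) i ≡⟨ z-nth m p ⟨
  z i ∎
  where
  open ≡-Reasoning
  eq : 2 ^ m + i ≡ length (Zfin m) + suc i
  eq = trans (cong (_+ i) (sym (length-Zfin m))) (sym (+-suc _ i))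
  lt : suc (2 ^ m + i) < 2 ^ suc m
  lt = subst₂ _<_ (+-suc (2 ^ m) i) (sym (2^-suc m)) (+-monoʳ-< (2 ^ m) p)

-- Here `f` is the 2-adic valuation of `suc i`. The induction follows Z_{m+1} = Z_m x_{m+1} Z_m:
-- left copy, central letter at position `2 ^ m`, right copy.
z-form : ∀ m i → suc i < 2 ^ m → ∃₂ λ f q → z i ≡ suc f × f < m × suc i ≡ 2 ^ f + q * 2 ^ suc f
z-form zero i (s≤s ())
z-form (suc m) i p with <-cmp (suc i) (2 ^ m)
... | tri< lt _ _ with z-form m i lt
...   | f , q , zi , f<m , eq = f , q , zi , m<n⇒m<1+n f<m , eq
z-form (suc m) i p | tri≈ _ eq _ =
  m , 0 , trans (cong (z ∘ pred) eq) (z-2^ m) , ≤-refl , trans eq (sym (+-identityʳ _))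
z-form (suc m) i p | tri> _ _ gt with m≤n⇒∃[o]m+o≡n (≤-pred gt)
... | o , refl with lt
  where
  lt : suc o < 2 ^ m
  lt = +-cancelˡ-< (2 ^ m) _ _ (subst₂ _<_ (sym (+-suc (2 ^ m) o)) (2^-suc m) p)
... | so with z-form m o so
-- Moving to the right copy adds `2 ^ m`, a multiple of `2 ^ suc f`, so the valuation is unchanged.
...   | f , q , zo , f<m , eq with 2^-∣ f<m
...     | divides r eqr = f , r + q , trans (z-shift m so) zo , m<n⇒m<1+n f<m , (begin
  suc (2 ^ m + o) ≡⟨ +-suc (2 ^ m) o ⟨
  2 ^ m + suc o ≡⟨ cong₂ _+_ eqr eq ⟩
  r * 2 ^ suc f + (2 ^ f + q * 2 ^ suc f) ≡⟨ solve 4 (λ r x y q → r :* x :+ (y :+ q :* x) := y :+ (r :+ q) :* x) refl r (2 ^ suc f) (2 ^ f) q ⟩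
  2 ^ f + (r + q) * 2 ^ suc f ∎)
  where
  open ≡-Reasoning
  open +-*-Solver

z-max : ∀ m {i} → suc i < 2 ^ m → z i ≤ m
z-max m {i} p with z-form m i p
... | f , q , zi , f<m , _ = subst (_≤ m) (sym zi) f<m

z-position : ∀ {i f} → z i ≡ suc f → ∃ λ q → suc i ≡ 2 ^ f + q * 2 ^ suc f
z-position {i} {f} zi with z-form (suc i) i (n<2^n (suc i))
... | g , q , zi′ , _ , eq with suc-injective (trans (sym zi′) zi)
... | refl = q , eq

-- Segments of Z

seg-suc : ∀ i n → seg i (suc n) ≡ z i ∷ seg (suc i) n
seg-suc i n = cong₂ _∷_ (cong z (+-identityʳ i)) (go n (λ j → j))
  where
  -- `upTo` unfolds to `applyUpTo` with a growing function, so the induction has to run over all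
  -- `g`.
  go : ∀ n (g : ℕ → ℕ) → map (λ j → z (i + j)) (applyUpTo (suc ∘ g) n) ≡ map (λ j → z (suc i + j)) (applyUpTo g n)
  go zero g = refl
  go (suc n) g = cong₂ _∷_ (cong z (+-suc i (g 0))) (go n (g ∘ suc))

length-seg : ∀ i n → length (seg i n) ≡ n
length-seg i n = trans (length-map _ (upTo n)) (length-upTo n)

seg-++ : ∀ i m n → seg i (m + n) ≡ seg i m ++ seg (i + m) n
seg-++ i zero n = cong (λ j → seg j n) (sym (+-identityʳ i))
seg-++ i (suc m) n = begin
  seg i (suc m + n) ≡⟨ seg-suc i (m + n) ⟩
  z i ∷ seg (suc i) (m + n) ≡⟨ cong (z i ∷_) (seg-++ (suc i) m n) ⟩
  z i ∷ seg (suc i) m ++ seg (suc i + m) n ≡⟨ cong₂ _++_ (sym (seg-suc i m)) (cong (λ j → seg j n) (sym (+-suc i m))) ⟩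
  seg i (suc m) ++ seg (i + suc m) n ∎
  where open ≡-Reasoning

seg-All : ∀ m i n → i + n < 2 ^ m → All (_≤ m) (seg i n)
seg-All m i zero p = []
seg-All m i (suc n) p = subst (All (_≤ m)) (sym (seg-suc i n))
  (z-max m (≤-trans (s≤s (s≤s (m≤m+n i n))) p′) ∷ seg-All m (suc i) n p′)
  where
  p′ : suc i + n < 2 ^ m
  p′ = subst (_< 2 ^ m) (+-suc i n) p

seg-shift : ∀ m i n → i + n < 2 ^ m → seg (2 ^ m + i) n ≡ seg i n
seg-shift m i zero p = refl
seg-shift m i (suc n) p = begin
  seg (2 ^ m + i) (suc n) ≡⟨ seg-suc (2 ^ m + i) n ⟩
  z (2 ^ m + i) ∷ seg (suc (2 ^ m + i)) n ≡⟨ cong₂ _∷_ (z-shift m (≤-trans (s≤s (s≤s (m≤m+n i n))) p′))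
       (trans (cong (λ j → seg j n) (sym (+-suc (2 ^ m) i))) (seg-shift m (suc i) n p′)) ⟩
  z i ∷ seg (suc i) n ≡⟨ seg-suc i n ⟨
  seg i (suc n) ∎
  where
  open ≡-Reasoning
  p′ : suc i + n < 2 ^ m
  p′ = subst (_< 2 ^ m) (+-suc i n) p

-- block a b is z_a ⋯ z_{b-1}.
block : ℕ → ℕ → List ℕ
block a b = seg a (b ∸ a)

length-block : ∀ a b → length (block a b) ≡ b ∸ a
length-block a b = length-seg a (b ∸ a)

block-empty : ∀ a → block a a ≡ []
block-empty a = cong (seg a) (n∸n≡0 a)

block-++ : ∀ {a b c} → a ≤ b → b ≤ c → block a c ≡ block a b ++ block b c
block-++ {a} a≤b b≤c with m≤n⇒∃[o]m+o≡n a≤b | m≤n⇒∃[o]m+o≡n b≤c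
... | m , refl | n , refl
  rewrite m+n∸m≡n a m | m+n∸m≡n (a + m) n | +-assoc a m n | m+n∸m≡n a (m + n) = seg-++ a m n

block-All : ∀ m {a b} → a ≤ b → b < 2 ^ m → All (_≤ m) (block a b)
block-All m {a} a≤b p = seg-All m a _ (subst (_< 2 ^ m) (sym (m+[n∸m]≡n a≤b)) p)

block-shift : ∀ m {a b} → a ≤ b → b < 2 ^ m → block (2 ^ m + a) (2 ^ m + b) ≡ block a b
block-shift m {a} {b} a≤b p = trans (cong (seg (2 ^ m + a)) ([m+n]∸[m+o]≡n∸o (2 ^ m) b a))
  (seg-shift m a (b ∸ a) (subst (_< 2 ^ m) (sym (m+[n∸m]≡n a≤b)) p))

≤pred2^ : ∀ f {a} → a < 2 ^ f → a ≤ pred (2 ^ f)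
≤pred2^ f p = ≤-pred (subst (_ <_) (sym (suc-pred-2^ f)) p)

pred2^<2^ : ∀ f → pred (2 ^ f) < 2 ^ f
pred2^<2^ f = ≤-reflexive (suc-pred-2^ f)

-- Position `2 ^ f` is index `pred (2 ^ f)`, and its letter is `suc f`.
block-around : ∀ f {a b} → a < 2 ^ f → 2 ^ f ≤ b →
  block a b ≡ block a (pred (2 ^ f)) ++ suc f ∷ block (2 ^ f) b
block-around f {a} {b} p q = begin
  block a b ≡⟨ block-++ (≤pred2^ f p) (≤-trans (<⇒≤ (pred2^<2^ f)) q) ⟩
  block a N ++ block N b ≡⟨ cong (block a N ++_) (block-++ (<⇒≤ (pred2^<2^ f)) q) ⟩
  block a N ++ block N (2 ^ f) ++ block (2 ^ f) b ≡⟨ cong (λ l → block a N ++ l ++ block (2 ^ f) b) single ⟩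
  block a N ++ suc f ∷ block (2 ^ f) b ∎
  where
  open ≡-Reasoning
  N = pred (2 ^ f)
  single : block N (2 ^ f) ≡ suc f ∷ []
  single = begin
    seg N (2 ^ f ∸ N) ≡⟨ cong (λ x → seg N (x ∸ N)) (sym (suc-pred-2^ f)) ⟩
    seg N (suc N ∸ N) ≡⟨ cong (seg N) (m+n∸n≡m 1 N) ⟩
    seg N 1 ≡⟨ seg-suc N 0 ⟩
    z N ∷ [] ≡⟨ cong (_∷ []) (z-2^ f) ⟩
    suc f ∷ [] ∎

-- Occurrences

Occurs : List ℕ → ℕ → Set
Occurs u c = u ≡ seg c (length u)

occurs-++ʳ : ∀ c xs {ys} → Occurs (xs ++ ys) c → Occurs ys (c + length xs)
occurs-++ʳ c [] {ys} eq = trans eq (cong (λ j → seg j (length ys)) (sym (+-identityʳ c)))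
occurs-++ʳ c (x ∷ xs) {ys} eq = subst (Occurs ys) (sym (+-suc c (length xs)))
  (occurs-++ʳ (suc c) xs (∷-injectiveʳ (trans eq (seg-suc c (length (xs ++ ys))))))

occurs-++ˡ : ∀ c xs {ys} → Occurs (xs ++ ys) c → Occurs xs c
occurs-++ˡ c [] eq = refl
occurs-++ˡ c (x ∷ xs) {ys} eq with ∷-injective (trans eq (seg-suc c (length (xs ++ ys))))
... | p , q = trans (cong₂ _∷_ p (occurs-++ˡ (suc c) xs q)) (sym (seg-suc c (length xs)))

occurs-letter : ∀ c xs {s ys} → Occurs (xs ++ s ∷ ys) c → z (c + length xs) ≡ s
occurs-letter c xs {s} {ys} occ =
  sym (∷-injectiveˡ (trans (occurs-++ʳ c xs occ) (seg-suc (c + length xs) (length ys))))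

occurs-seg : ∀ i n → Occurs (seg i n) i
occurs-seg i n = cong (seg i) (sym (length-seg i n))

occurs-position : ∀ c f xs {ys} → Occurs (xs ++ suc f ∷ ys) c →
  ∃ λ q → suc (c + length xs) ≡ 2 ^ f + q * 2 ^ suc f
occurs-position c f xs occ = z-position (occurs-letter c xs occ)

-- The letters `suc f` and `suc e`, taken from positions `2 ^ f` and `2 ^ e`, fix where each block
-- can reappear: c ≡ a modulo `2 ^ suc f`, and c + (b - a) ≡ a′ modulo `2 ^ suc e`, hence also
-- modulo `2 ^ suc f`. Subtracting gives the claim.
juxtaposition-congruence : ∀ c {a b a′} f e → f ≤ e → a < 2 ^ f → 2 ^ f ≤ b → b ≤ a′ → a′ < 2 ^ e →
  Occurs (block a b ++ block a′ (2 ^ e)) c → 2 ^ suc f ∣ a′ ∸ b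
juxtaposition-congruence c {a} {b} {a′} f e f≤e a<2^f 2^f≤b b≤a′ a′<2^e occ =
  ∣m+n∣m⇒∣n (subst (2 ^ suc f ∣_) (trans key (+-comm (a′ ∸ b) _)) (divides q refl)) (∣-trans (2^-∣ (s≤s f≤e)) (divides q′ refl))
  where
  open ≡-Reasoning
  occ₁ : Occurs (block a (pred (2 ^ f)) ++ suc f ∷ (block (2 ^ f) b ++ block a′ (2 ^ e))) c
  occ₁ = subst (λ l → Occurs l c)
    (trans (cong (_++ block a′ (2 ^ e)) (block-around f a<2^f 2^f≤b)) (++-assoc (block a (pred (2 ^ f))) _ _)) occ
  occ₂ : Occurs ((block a b ++ block a′ (pred (2 ^ e))) ++ suc e ∷ block (2 ^ e) (2 ^ e)) c
  occ₂ = subst (λ l → Occurs l c)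
    (trans (cong (block a b ++_) (block-around e a′<2^e ≤-refl)) (sym (++-assoc (block a b) _ _))) occ
  pos₁ = occurs-position c f (block a (pred (2 ^ f))) occ₁
  pos₂ = occurs-position c e (block a b ++ block a′ (pred (2 ^ e))) occ₂
  q = proj₁ pos₁
  q′ = proj₁ pos₂
  gap : ∀ c g l x → x < 2 ^ g → suc (c + (l + length (block x (pred (2 ^ g))))) + x ≡ c + l + 2 ^ g
  gap c g l x p = begin
    suc (c + (l + length (block x (pred (2 ^ g))))) + x
      ≡⟨ cong (λ k → suc (c + (l + k)) + x) (length-block x _) ⟩
    suc (c + (l + (pred (2 ^ g) ∸ x))) + x
      ≡⟨ solve 4 (λ c l k x → con 1 :+ (c :+ (l :+ k)) :+ x := c :+ l :+ (con 1 :+ (k :+ x))) refl c l (pred (2 ^ g) ∸ x) x ⟩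
    c + l + suc (pred (2 ^ g) ∸ x + x)
      ≡⟨ cong (λ k → c + l + suc k) (m∸n+n≡m (≤pred2^ g p)) ⟩
    c + l + suc (pred (2 ^ g))
      ≡⟨ cong (c + l +_) (suc-pred-2^ g) ⟩
    c + l + 2 ^ g ∎
    where open +-*-Solver
  -- The copy of the block from `x` begins at `c + l`; its letter `suc g` has moved from `2 ^ g` to
  -- `2 ^ g + r`, so the whole copy is displaced by `r`.
  solve-start : ∀ c g l x r → suc (c + (l + length (block x (pred (2 ^ g))))) ≡ 2 ^ g + r → x < 2 ^ g → c + l ≡ x + r
  solve-start c g l x r eq p = +-cancelʳ-≡ (2 ^ g) _ _ (begin
    c + l + 2 ^ g ≡⟨ gap c g l x p ⟨
    suc (c + (l + length (block x (pred (2 ^ g))))) + x ≡⟨ cong (_+ x) eq ⟩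
    2 ^ g + r + x ≡⟨ solve 3 (λ g r x → g :+ r :+ x := x :+ r :+ g) refl (2 ^ g) r x ⟩
    x + r + 2 ^ g ∎)
    where open +-*-Solver
  start₁ : c + 0 ≡ a + q * 2 ^ suc f
  start₁ = solve-start c f 0 a _ (proj₂ pos₁) a<2^f
  start₂ : c + (b ∸ a) ≡ a′ + q′ * 2 ^ suc e
  start₂ = solve-start c e (b ∸ a) a′ _ (trans (cong (λ k → suc (c + k))
    (sym (trans (length-++ (block a b)) (cong (_+ length (block a′ (pred (2 ^ e)))) (length-block a b))))) (proj₂ pos₂)) a′<2^e
  a≤b = ≤-trans (<⇒≤ a<2^f) 2^f≤b
  key : q * 2 ^ suc f ≡ a′ ∸ b + q′ * 2 ^ suc e
  key = +-cancelˡ-≡ b _ _ (begin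
    b + q * 2 ^ suc f ≡⟨ cong (_+ q * 2 ^ suc f) (sym (m+[n∸m]≡n a≤b)) ⟩
    a + (b ∸ a) + q * 2 ^ suc f ≡⟨ solve 3 (λ a d r → a :+ d :+ r := a :+ r :+ d) refl a (b ∸ a) (q * 2 ^ suc f) ⟩
    a + q * 2 ^ suc f + (b ∸ a) ≡⟨ cong (_+ (b ∸ a)) (trans (sym start₁) (+-identityʳ c)) ⟩
    c + (b ∸ a) ≡⟨ start₂ ⟩
    a′ + q′ * 2 ^ suc e ≡⟨ cong (_+ q′ * 2 ^ suc e) (sym (m+[n∸m]≡n b≤a′)) ⟩
    b + (a′ ∸ b) + q′ * 2 ^ suc e ≡⟨ +-assoc b _ _ ⟩
    b + (a′ ∸ b + q′ * 2 ^ suc e) ∎)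
    where open +-*-Solver

-- Binary expansions

-- The elements i of A ∩ [1, m] are read as binary digits of weight 2 ^ (i - 1).
value : (ℕ → Bool) → ℕ → ℕ
value A zero    = 0
value A (suc m) = value A m + (if A (suc m) then 2 ^ m else 0)

-- Complementary digits add up without carries to m ones, that is, to `2 ^ m` minus one.
value-complement : ∀ A B m → (∀ i → 1 ≤ i → i ≤ m → A i ≡ not (B i)) →
  suc (value A m + value B m) ≡ 2 ^ m
value-complement A B zero c = refl
value-complement A B (suc m) c
  with A (suc m) | B (suc m) | c (suc m) (s≤s z≤n) ≤-refl
     | value-complement A B m (λ i p q → c i p (m≤n⇒m≤1+n q))
... | true | false | refl | ih = begin
  suc (value A m + 2 ^ m + (value B m + 0))
    ≡⟨ solve 3 (λ a b p → con 1 :+ (a :+ p :+ (b :+ con 0)) := con 1 :+ (a :+ b) :+ (p :+ con 0)) refl (value A m) (value B m) (2 ^ m) ⟩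
  suc (value A m + value B m) + (2 ^ m + 0) ≡⟨ cong (_+ (2 ^ m + 0)) ih ⟩
  2 ^ suc m ∎
  where open ≡-Reasoning; open +-*-Solver
... | false | true | refl | ih = begin
  suc (value A m + 0 + (value B m + 2 ^ m))
    ≡⟨ solve 3 (λ a b p → con 1 :+ (a :+ con 0 :+ (b :+ p)) := con 1 :+ (a :+ b) :+ (p :+ con 0)) refl (value A m) (value B m) (2 ^ m) ⟩
  suc (value A m + value B m) + (2 ^ m + 0) ≡⟨ cong (_+ (2 ^ m + 0)) ih ⟩
  2 ^ suc m ∎
  where open ≡-Reasoning; open +-*-Solver

value-not : ∀ A m → value A m + value (not ∘ A) m ≡ pred (2 ^ m)
value-not A m = cong pred (value-complement A (not ∘ A) m (λ i _ _ → sym (not-involutive (A i))))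

value≤ : ∀ A m → value A m ≤ pred (2 ^ m)
value≤ A m = subst (value A m ≤_) (value-not A m) (m≤m+n _ _)

value< : ∀ A m → value A m < 2 ^ m
value< A m = ≤-<-trans (value≤ A m) (pred2^<2^ m)

value-cong : ∀ {A B} m → (∀ i → A i ≡ B i) → value A m ≡ value B m
value-cong zero h = refl
value-cong (suc m) h = cong₂ (λ v b → v + (if b then 2 ^ m else 0)) (value-cong m h) (h (suc m))

value-mod : ∀ A {e m} → e ≤ m → ∃ λ q → value A m ≡ value A e + q * 2 ^ e
value-mod A {e} e≤m = go (≤⇒≤′ e≤m)
  where
  go : ∀ {m} → e ≤′ m → ∃ λ q → value A m ≡ value A e + q * 2 ^ e
  go ≤′-refl = 0 , sym (+-identityʳ _)
  go (≤′-step {m} p) with A (suc m) | go p | 2^-∣ (≤′⇒≤ p)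
  ... | false | q , eq | _ = q , trans (+-identityʳ _) eq
  ... | true | q , eq | divides r eq′ = q + r , (begin
    value A m + 2 ^ m ≡⟨ cong₂ _+_ eq eq′ ⟩
    value A e + q * 2 ^ e + r * 2 ^ e
      ≡⟨ solve 4 (λ v q r p → v :+ q :* p :+ r :* p := v :+ (q :+ r) :* p) refl (value A e) q r (2 ^ e) ⟩
    value A e + (q + r) * 2 ^ e ∎)
    where open ≡-Reasoning; open +-*-Solver

-- The largest index missing from A is the leading digit of the number whose digits are the
-- complement of A; digit `suc e` has weight `2 ^ e`.
eta-value : ∀ A m e → 2 ^ e ≤ value (not ∘ A) m → value (not ∘ A) m < 2 ^ suc e → eta A (suc m) ≡ suc e
eta-value A zero e lo hi = contradiction (≤-trans (m^n>0 2 e) lo) λ ()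
eta-value A (suc m) e lo hi with A (suc m) | value< (not ∘ A) m
... | true | _ = eta-value A m e (subst (2 ^ e ≤_) (+-identityʳ _) lo) (subst (_< 2 ^ suc e) (+-identityʳ _) hi)
-- With `suc m` missing from A, the value lies between `2 ^ m` and `2 ^ suc m`, which forces e = m.
... | false | v< = cong suc (≤-antisym
  (≤-pred (2^-cancel-< (≤-<-trans (m≤n+m (2 ^ m) _) hi)))
  (≤-pred (2^-cancel-< (≤-<-trans lo (subst (value (not ∘ A) m + 2 ^ m <_) (sym (2^-suc m)) (+-monoˡ-< (2 ^ m) v<))))))

-- Binary digits of a number

half : ℕ → ℕ → ℕ
half zero x    = x
half (suc j) x = half j x / 2

-- Digits are numbered from 1 to match `value`; the entry at 0 is a default.
bit : ℕ → ℕ → Bool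
bit x zero    = false
bit x (suc j) = (half j x % 2) ≡ᵇ 1

if-parity : ∀ r p → r < 2 → (if r ≡ᵇ 1 then p else 0) ≡ r * p
if-parity zero p _ = refl
if-parity (suc zero) p _ = sym (+-identityʳ p)
if-parity (suc (suc r)) p (s≤s (s≤s ()))

-- Invariant of repeated halving: the m digits already read, plus the remaining quotient, make up x.
value-bit-half : ∀ x m → value (bit x) m + half m x * 2 ^ m ≡ x
value-bit-half x zero = *-identityʳ x
value-bit-half x (suc m) = begin
  value (bit x) m + (if bit x (suc m) then 2 ^ m else 0) + h / 2 * 2 ^ suc m
    ≡⟨ cong (λ t → value (bit x) m + t + h / 2 * 2 ^ suc m) (if-parity (h % 2) (2 ^ m) (m%n<n h 2)) ⟩
  value (bit x) m + h % 2 * 2 ^ m + h / 2 * 2 ^ suc m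
    ≡⟨ solve 4 (λ v r q p → v :+ r :* p :+ q :* (con 2 :* p) := v :+ (r :+ q :* con 2) :* p) refl (value (bit x) m) (h % 2) (h / 2) (2 ^ m) ⟩
  value (bit x) m + (h % 2 + h / 2 * 2) * 2 ^ m
    ≡⟨ cong (λ t → value (bit x) m + t * 2 ^ m) (sym (m≡m%n+[m/n]*n h 2)) ⟩
  value (bit x) m + h * 2 ^ m
    ≡⟨ value-bit-half x m ⟩
  x ∎
  where
  open ≡-Reasoning
  open +-*-Solver
  h = half m x

value-bit : ∀ {x} m → x < 2 ^ m → value (bit x) m ≡ x
value-bit {x} m p with half m x | value-bit-half x m
... | zero  | eq = trans (sym (+-identityʳ _)) eq
... | suc h | eq = contradiction (subst (2 ^ m ≤_) eq (≤-trans (m≤m+n (2 ^ m) (h * 2 ^ m)) (m≤n+m _ (value (bit x) m)))) (<⇒≱ p)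

half-+ : ∀ j d x q → half j (x + q * 2 ^ (d + j)) ≡ half j x + q * 2 ^ d
half-+ zero d x q = cong (λ t → x + q * 2 ^ t) (+-identityʳ d)
half-+ (suc j) d x q = begin
  half j (x + q * 2 ^ (d + suc j)) / 2 ≡⟨ cong (λ t → half j (x + q * 2 ^ t) / 2) (+-suc d j) ⟩
  half j (x + q * 2 ^ (suc d + j)) / 2 ≡⟨ cong (_/ 2) (half-+ j (suc d) x q) ⟩
  (half j x + q * 2 ^ suc d) / 2 ≡⟨ cong (λ t → (half j x + t) / 2) even ⟩
  (half j x + q * 2 ^ d * 2) / 2 ≡⟨ +-distrib-/-∣ʳ (half j x) (divides (q * 2 ^ d) refl) ⟩
  half j x / 2 + q * 2 ^ d * 2 / 2 ≡⟨ cong (half j x / 2 +_) (m*n/n≡m (q * 2 ^ d) 2) ⟩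
  half j x / 2 + q * 2 ^ d ∎
  where
  open ≡-Reasoning
  open +-*-Solver
  even : q * 2 ^ suc d ≡ q * 2 ^ d * 2
  even = solve 2 (λ q p → q :* (con 2 :* p) := q :* p :* con 2) refl q (2 ^ d)

-- Digit i is read after i - 1 halvings, when the added multiple of `2 ^ e` is still even.
bit-+ : ∀ {i e} x q → i ≤ e → bit (x + q * 2 ^ e) i ≡ bit x i
bit-+ {zero} x q _ = refl
bit-+ {suc j} {e} x q p with e ∸ suc j | m∸n+n≡m p
... | d | refl = cong (_≡ᵇ 1) (begin
  half j (x + q * 2 ^ (d + suc j)) % 2 ≡⟨ cong (λ t → half j (x + q * 2 ^ t) % 2) (+-suc d j) ⟩
  half j (x + q * 2 ^ (suc d + j)) % 2 ≡⟨ cong (_% 2) (half-+ j (suc d) x q) ⟩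
  (half j x + q * 2 ^ suc d) % 2
    ≡⟨ cong (λ t → (half j x + t) % 2) (solve 2 (λ q p → q :* (con 2 :* p) := q :* p :* con 2) refl q (2 ^ d)) ⟩
  (half j x + q * 2 ^ d * 2) % 2 ≡⟨ [m+kn]%n≡m%n (half j x) (q * 2 ^ d) 2 ⟩
  half j x % 2 ∎)
  where open ≡-Reasoning; open +-*-Solver

-- The words u_A and v_B

pred-2^-suc : ∀ m → pred (2 ^ suc m) ≡ 2 ^ m + pred (2 ^ m)
pred-2^-suc m = suc-injective (begin
  suc (pred (2 ^ suc m)) ≡⟨ suc-pred-2^ (suc m) ⟩
  2 ^ suc m ≡⟨ 2^-suc m ⟩
  2 ^ m + 2 ^ m ≡⟨ cong (2 ^ m +_) (sym (suc-pred-2^ m)) ⟩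
  2 ^ m + suc (pred (2 ^ m)) ≡⟨ +-suc (2 ^ m) _ ⟩
  suc (2 ^ m + pred (2 ^ m)) ∎)
  where open ≡-Reasoning

block-prefix-shift : ∀ m {b} → b < 2 ^ m → block (2 ^ m) (2 ^ m + b) ≡ block 0 b
block-prefix-shift m {b} p = trans (cong (λ a → block a (2 ^ m + b)) (sym (+-identityʳ (2 ^ m)))) (block-shift m z≤n p)

block-extend : ∀ m {a b} → a < 2 ^ m → b < 2 ^ m →
  block a (2 ^ m + b) ≡ block a (pred (2 ^ m)) ++ suc m ∷ block 0 b
block-extend m {a} {b} p q = trans (block-around m p (m≤m+n _ _))
  (cong (λ l → block a (pred (2 ^ m)) ++ suc m ∷ l) (block-prefix-shift m q))

Zfin-block : ∀ m → Zfin m ≡ block 0 (pred (2 ^ m))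
Zfin-block zero = refl
Zfin-block (suc m) = begin
  Zfin m ++ suc m ∷ Zfin m ≡⟨ cong (λ l → l ++ suc m ∷ l) (Zfin-block m) ⟩
  block 0 (pred (2 ^ m)) ++ suc m ∷ block 0 (pred (2 ^ m)) ≡⟨ block-extend m (m^n>0 2 m) (pred2^<2^ m) ⟨
  block 0 (2 ^ m + pred (2 ^ m)) ≡⟨ cong (block 0) (pred-2^-suc m) ⟨
  block 0 (pred (2 ^ suc m)) ∎
  where open ≡-Reasoning

uPre≡Zfin : ∀ m → uPre m ≡ Zfin m
uPre≡Zfin zero = refl
uPre≡Zfin (suc m) = cong (λ l → l ++ suc m ∷ l) (uPre≡Zfin m)

vPre≡Zfin : ∀ m → vPre m ≡ Zfin m
vPre≡Zfin zero = refl
vPre≡Zfin (suc m) = trans (++-assoc (vPre m) _ _) (cong (λ l → l ++ suc m ∷ l) (vPre≡Zfin m))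

-- The word u_A is the suffix of Z_m of length `value A m`. If `suc m` is in A, the letter `suc m`
-- and a copy of Z_m are appended; otherwise the same word is reread in the right copy of Z_m, which
-- moves its start by `2 ^ m`.
uSel-block : ∀ A m → uSel A (suc m) ≡ block (value (not ∘ A) m) (pred (2 ^ m))
-- Index 0 contributes the empty word `uw 0` in either case.
uSel-block A zero with A 0
... | true  = refl
... | false = refl
uSel-block A (suc m) with A (suc m) | uSel-block A m
... | true | ih = begin
  uSel A (suc m) ++ suc m ∷ uPre m ≡⟨ cong₂ (λ l r → l ++ suc m ∷ r) ih (trans (uPre≡Zfin m) (Zfin-block m)) ⟩
  block v (pred (2 ^ m)) ++ suc m ∷ block 0 (pred (2 ^ m)) ≡⟨ block-extend m (value< (not ∘ A) m) (pred2^<2^ m) ⟨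
  block v (2 ^ m + pred (2 ^ m)) ≡⟨ cong₂ block (sym (+-identityʳ v)) (sym (pred-2^-suc m)) ⟩
  block (v + 0) (pred (2 ^ suc m)) ∎
  where
  open ≡-Reasoning
  v = value (not ∘ A) m
... | false | ih = begin
  uSel A (suc m) ++ [] ≡⟨ ++-identityʳ _ ⟩
  uSel A (suc m) ≡⟨ ih ⟩
  block v (pred (2 ^ m)) ≡⟨ block-shift m (value≤ (not ∘ A) m) (pred2^<2^ m) ⟨
  block (2 ^ m + v) (2 ^ m + pred (2 ^ m)) ≡⟨ cong₂ block (+-comm (2 ^ m) v) (sym (pred-2^-suc m)) ⟩
  block (v + 2 ^ m) (pred (2 ^ suc m)) ∎
  where
  open ≡-Reasoning
  v = value (not ∘ A) m

-- Dually, v_B is a prefix of Z_m: including `suc m` puts Z_m and the letter `suc m` in front.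
vSel-block : ∀ B m → vSel B (suc m) ≡ block 0 (value B m)
vSel-block B zero with B 0
... | true  = refl
... | false = refl
vSel-block B (suc m) with B (suc m) | vSel-block B m
... | true | ih = begin
  (vPre m ++ suc m ∷ []) ++ vSel B (suc m) ≡⟨ ++-assoc (vPre m) _ _ ⟩
  vPre m ++ suc m ∷ vSel B (suc m) ≡⟨ cong₂ (λ l r → l ++ suc m ∷ r) (trans (vPre≡Zfin m) (Zfin-block m)) ih ⟩
  block 0 (pred (2 ^ m)) ++ suc m ∷ block 0 v ≡⟨ block-extend m (m^n>0 2 m) (value< B m) ⟨
  block 0 (2 ^ m + v) ≡⟨ cong (block 0) (+-comm (2 ^ m) v) ⟩
  block 0 (v + 2 ^ m) ∎
  where
  open ≡-Reasoning
  v = value B m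
... | false | ih = trans ih (cong (block 0) (sym (+-identityʳ _)))

length-uSel : ∀ A m → length (uSel A (suc m)) ≡ value A m
length-uSel A m = begin
  length (uSel A (suc m)) ≡⟨ cong length (uSel-block A m) ⟩
  length (block v (pred (2 ^ m))) ≡⟨ length-block v _ ⟩
  pred (2 ^ m) ∸ v ≡⟨ cong (_∸ v) (value-not A m) ⟨
  value A m + v ∸ v ≡⟨ m+n∸n≡m (value A m) v ⟩
  value A m ∎
  where
  open ≡-Reasoning
  v = value (not ∘ A) m

length-vSel : ∀ B m → length (vSel B (suc m)) ≡ value B m
length-vSel B m = trans (cong length (vSel-block B m)) (length-block 0 _)

-- Red factors

kmax-upper : ∀ {n xs} → All (_≤ n) xs → kmax xs ≤ n
kmax-upper [] = z≤n
kmax-upper (p ∷ ps) = ⊔-lub p (kmax-upper ps)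

kmax-lower : ∀ xs {x ys} → x ≤ kmax (xs ++ x ∷ ys)
kmax-lower [] = m≤m⊔n _ _
kmax-lower (y ∷ xs) = ≤-trans (kmax-lower xs) (m≤n⊔m y _)

kmax-middle : ∀ {f xs ys} → All (_≤ f) xs → All (_≤ suc f) ys → kmax (xs ++ suc f ∷ ys) ≡ suc f
kmax-middle {xs = xs} ps qs =
  ≤-antisym (kmax-upper (++⁺ (All.map m≤n⇒m≤1+n ps) (≤-refl ∷ qs))) (kmax-lower xs)

-- Both sides are cut at the first letter exceeding f. This supplies the uniqueness of the
-- decomposition u_A x_k v_B.
first-occurrence : ∀ {f xs xs′ ys ys′} → All (_≤ f) xs → All (_≤ f) xs′ →
  xs ++ suc f ∷ ys ≡ xs′ ++ suc f ∷ ys′ → xs ≡ xs′ × ys ≡ ys′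
first-occurrence [] [] eq = refl , ∷-injectiveʳ eq
first-occurrence [] (q ∷ qs) eq = contradiction (subst (_≤ _) (sym (∷-injectiveˡ eq)) q) (<-irrefl refl)
first-occurrence (p ∷ ps) [] eq = contradiction (subst (_≤ _) (∷-injectiveˡ eq) p) (<-irrefl refl)
first-occurrence (p ∷ ps) (q ∷ qs) eq with ∷-injective eq
... | refl , eq′ with first-occurrence ps qs eq′
... | refl , eq″ = refl , eq″

-- The word has length `value A f + 1 + value B f`. The number `a` is the value of the complement of
-- A, so η is `suc e`; redness makes the e lowest digits of A and B complementary, and the length
-- vanishes modulo `2 ^ e`.
red⇒∣ : ∀ f e {a xs ys} → All (_≤ f) xs → All (_≤ suc f) ys → suc (length xs + a) ≡ 2 ^ f →
  2 ^ e ≤ a → a < 2 ^ suc e → FactorRed (xs ++ suc f ∷ ys) → 2 ^ e ∣ length (xs ++ suc f ∷ ys)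
red⇒∣ f e {a} {xs} {ys} ps qs len lo hi (A , B , eq , compl)
  rewrite kmax-middle {f} {xs} {ys} ps qs
  -- Whatever the witnesses A and B are, u_A must be `xs` and v_B must be `ys`.
  with first-occurrence ps (subst (All (_≤ f)) (sym (uSel-block A f)) (block-All f (value≤ (not ∘ A) f) (pred2^<2^ f))) eq
... | refl , refl = divides (1 + (qA + qB)) (begin
  length (uSel A (suc f) ++ suc f ∷ vSel B (suc f)) ≡⟨ length-++ (uSel A (suc f)) ⟩
  length (uSel A (suc f)) + suc (length (vSel B (suc f)))
    ≡⟨ cong₂ (λ x y → x + suc y) (trans (length-uSel A f) (proj₂ modA)) (trans (length-vSel B f) (proj₂ modB)) ⟩
  (value A e + qA * 2 ^ e) + suc (value B e + qB * 2 ^ e)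
    ≡⟨ solve 5 (λ a b x y p → (a :+ x :* p) :+ (con 1 :+ (b :+ y :* p)) := (con 1 :+ (a :+ b)) :+ (x :+ y) :* p) refl
         (value A e) (value B e) qA qB (2 ^ e) ⟩
  suc (value A e + value B e) + (qA + qB) * 2 ^ e
    ≡⟨ cong (_+ (qA + qB) * 2 ^ e) (value-complement A B e
         (λ i 1≤i i≤e → compl i 1≤i (subst (i <_) (sym eta≡) (s≤s i≤e)))) ⟩
  2 ^ e + (qA + qB) * 2 ^ e ∎)
  where
  open ≡-Reasoning
  open +-*-Solver
  a≡ : value (not ∘ A) f ≡ a
  a≡ = +-cancelˡ-≡ (value A f) _ _ (begin
    value A f + value (not ∘ A) f ≡⟨ value-not A f ⟩
    pred (2 ^ f) ≡⟨ cong pred len ⟨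
    length (uSel A (suc f)) + a ≡⟨ cong (_+ a) (length-uSel A f) ⟩
    value A f + a ∎)
  eta≡ : eta A (suc f) ≡ suc e
  eta≡ = eta-value A f e (subst (2 ^ e ≤_) (sym a≡) lo) (subst (_< 2 ^ suc e) (sym a≡) hi)
  e≤f : e ≤ f
  e≤f = <⇒≤ (2^-cancel-< (≤-<-trans lo (subst (_< 2 ^ f) a≡ (value< (not ∘ A) f))))
  modA = value-mod A e≤f
  modB = value-mod B e≤f
  qA = proj₁ modA
  qB = proj₁ modB

∣⇒red : ∀ f e {a b} → 2 ^ e ≤ a → a < 2 ^ suc e → a < 2 ^ f → 2 ^ f ≤ b → b < 2 ^ suc f →
  2 ^ e ∣ b ∸ a → FactorRed (block a b)
∣⇒red f e {a} {b} lo hi a<2^f 2^f≤b b<2^sf (divides q eq) =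
  subst FactorRed (sym decomp) (A , B , word , compl)
  where
  open ≡-Reasoning
  N = pred (2 ^ f)
  t = b ∸ 2 ^ f
  -- Chosen so that u_A runs from `a` up to the letter at position `2 ^ f` and v_B is the prefix of
  -- length `t`.
  A = not ∘ bit a
  B = bit t
  b≡ : 2 ^ f + t ≡ b
  b≡ = m+[n∸m]≡n 2^f≤b
  t< : t < 2 ^ f
  t< = +-cancelˡ-< (2 ^ f) t _ (subst₂ _<_ (sym b≡) (2^-suc f) b<2^sf)
  decomp : block a b ≡ block a N ++ suc f ∷ block 0 t
  decomp = trans (cong (block a) (sym b≡)) (block-extend f a<2^f t<)
  a≡ : value (not ∘ A) f ≡ a
  a≡ = trans (value-cong f (λ i → not-involutive (bit a i))) (value-bit f a<2^f)
  k≡ : kmax (block a N ++ suc f ∷ block 0 t) ≡ suc f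
  k≡ = kmax-middle (block-All f (≤pred2^ f a<2^f) (pred2^<2^ f))
    (All.map m≤n⇒m≤1+n (block-All f z≤n t<))
  word′ : block a N ++ suc f ∷ block 0 t ≡ uSel A (suc f) ++ suc f ∷ vSel B (suc f)
  word′ = cong₂ (λ l r → l ++ suc f ∷ r)
    (sym (trans (uSel-block A f) (cong (λ x → block x N) a≡)))
    (sym (trans (vSel-block B f) (cong (block 0) (value-bit f t<))))
  word = subst (λ k → block a N ++ suc f ∷ block 0 t ≡ uSel A k ++ k ∷ vSel B k) (sym k≡) word′
  e≤f : e ≤ f
  e≤f = <⇒≤ (2^-cancel-< (≤-<-trans lo a<2^f))
  -- Both b - a and b - t = `2 ^ f` are multiples of `2 ^ e`, so a, b and t share their e lowest
  -- digits.
  bits : ∀ i → i ≤ e → bit a i ≡ bit t i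
  bits i i≤e with 2^-∣ e≤f
  ... | divides r eqr = begin
    bit a i ≡⟨ bit-+ a q i≤e ⟨
    bit (a + q * 2 ^ e) i ≡⟨ cong (λ x → bit x i) (trans (cong (a +_) (sym eq)) (m+[n∸m]≡n (≤-trans (<⇒≤ a<2^f) 2^f≤b))) ⟩
    bit b i ≡⟨ cong (λ x → bit x i) (trans (sym b≡) (trans (+-comm (2 ^ f) t) (cong (t +_) eqr))) ⟩
    bit (t + r * 2 ^ e) i ≡⟨ bit-+ t r i≤e ⟩
    bit t i ∎
  compl : ∀ i → 1 ≤ i → i < eta A (kmax (block a N ++ suc f ∷ block 0 t)) → A i ≡ not (B i)
  compl i _ p = cong not (bits i (≤-pred (subst (i <_) eta≡ p)))
    where
    eta≡ = trans (cong (eta A) k≡)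
      (eta-value A f e (subst (2 ^ e ≤_) (sym a≡) lo) (subst (_< 2 ^ suc e) (sym a≡) hi))

-- Super-monochromatic factorisations

-- Write d as q and `2 ^ e` as r multiples of `2 ^ s`. Since b is below one such unit, r < q + 1.
2^∣⇒≤ : ∀ {s e b d} → s ≤ e → b < 2 ^ s → 2 ^ e ≤ b + d → 2 ^ s ∣ d → 2 ^ e ≤ d
2^∣⇒≤ {s} {e} {b} s≤e b< le (divides q refl) with 2^-∣ s≤e
... | divides r eqr = subst (_≤ q * 2 ^ s) (sym eqr) (*-monoˡ-≤ (2 ^ s) (≤-pred (*-cancelʳ-< (2 ^ s) r (suc q)
  (subst (_< suc q * 2 ^ s) eqr (≤-<-trans le (+-monoˡ-< (q * 2 ^ s) b<))))))

++-split : ∀ {A : Set} (xs : List A) {ys} ps {x qs} → xs ++ ys ≡ ps ++ x ∷ qs →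
  (∃ λ r → xs ≡ ps ++ x ∷ r) ⊎ (∃ λ r → ys ≡ r ++ x ∷ qs)
++-split [] ps eq = inj₂ (ps , eq)
++-split (y ∷ xs) [] eq = inj₁ (xs , cong (_∷ xs) (∷-injectiveˡ eq))
++-split (y ∷ xs) (p ∷ ps) eq with ++-split xs ps (∷-injectiveʳ eq)
... | inj₁ (r , eq′) = inj₁ (r , cong₂ _∷_ (∷-injectiveˡ eq) eq′)
... | inj₂ s = inj₂ s

block-nonempty : ∀ {a b} → a < b → block a b ≢ []
block-nonempty {a} {b} a<b eq = contradiction (trans (sym (length-block a b)) (cong length eq)) (m>n⇒m∸n≢0 a<b)

block-factor : ∀ {a b} → a < b → IsFactor (block a b)
block-factor {a} {b} a<b = block-nonempty a<b , a , occurs-seg a (b ∸ a)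

-- Cuts separated by powers of two

module SparseCuts (b E : ℕ → ℕ)
  (lo : ∀ i → 2 ^ E i ≤ b i) (hi : ∀ i → b i < 2 ^ suc (E i)) (gap : ∀ i → b i < 2 ^ E (suc i)) where

  W : ℕ → List ℕ
  W i = block (b i) (b (suc i))

  b< : ∀ i → b i < b (suc i)
  b< i = <-≤-trans (gap i) (lo (suc i))

  E< : ∀ i → E i < E (suc i)
  E< i = 2^-cancel-< (≤-<-trans (lo i) (gap i))

  W-around : ∀ i → W i ≡ block (b i) (pred (2 ^ E (suc i))) ++ suc (E (suc i)) ∷ block (2 ^ E (suc i)) (b (suc i))
  W-around i = block-around (E (suc i)) (gap i) (lo (suc i))

  ∣⇒W-red : ∀ i → 2 ^ suc (E i) ∣ b (suc i) ∸ b i → FactorRed (W i)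
  ∣⇒W-red i d = ∣⇒red (E (suc i)) (E i) (lo i) (hi i) (gap i) (lo (suc i)) (hi (suc i))
    (∣-trans (2^-∣ (n≤1+n (E i))) d)

  -- The prefix `xs` is empty for `W 2` and equal to `W 0` for `W 0 ++ W 2`. In the latter case `a`
  -- is the index at which a suffix of Z_{E 3} with as many letters before the maximal one would
  -- start.
  W-red⇒∣ : ∀ i e {a} xs → All (_≤ E (suc i)) xs →
    suc (length xs + (pred (2 ^ E (suc i)) ∸ b i) + a) ≡ 2 ^ E (suc i) → 2 ^ e ≤ a → a < 2 ^ suc e →
    FactorRed (xs ++ W i) → 2 ^ e ∣ length (xs ++ W i)
  W-red⇒∣ i e {a} xs all len lo′ hi′ = subst (λ u → FactorRed u → 2 ^ e ∣ length u) (sym eq)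
    (red⇒∣ f e (++⁺ all (block-All f (≤pred2^ f (gap i)) (pred2^<2^ f)))
      (block-All (suc f) (lo (suc i)) (hi (suc i)))
      (trans (cong (λ l → suc (l + a)) (trans (length-++ xs) (cong (length xs +_) (length-block (b i) _)))) len)
      lo′ hi′)
    where
    f = E (suc i)
    eq : xs ++ W i ≡ (xs ++ block (b i) (pred (2 ^ f))) ++ suc f ∷ block (2 ^ f) (b (suc i))
    eq = trans (cong (xs ++_) (W-around i)) (sym (++-assoc xs _ _))

  -- Serves both colours: for red it bounds `b 2 ∸ b 1` from below, for blue it would make `W 1`
  -- red.
  occurs-skip : ∀ i c → Occurs (W i ++ block (b (2 + i)) (2 ^ E (3 + i))) c →
    2 ^ suc (E (suc i)) ∣ b (2 + i) ∸ b (suc i)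
  occurs-skip i c = juxtaposition-congruence c (E (1 + i)) (E (3 + i))
    (<⇒≤ (<-trans (E< (1 + i)) (E< (2 + i)))) (gap i) (lo (1 + i)) (<⇒≤ (b< (1 + i))) (gap (2 + i))

  red-impossible : IsFactor (W 0 ++ W 2) → FactorRed (W 0 ++ W 2) → ¬ FactorRed (W 2)
  red-impossible (_ , c , occ) red₀₂ red₂ = <⇒≱ short (∣⇒≤ {{≢-nonZero (m>n⇒m∸n≢0 (b< 0))}} b₁∸b₀)
    where
    open ≡-Reasoning
    open +-*-Solver
    N = pred (2 ^ E 3)
    d = b 2 ∸ b 1
    2^∣d : 2 ^ suc (E 1) ∣ d
    2^∣d = occurs-skip 0 c (occurs-++ˡ c (W 0 ++ block (b 2) (2 ^ E 3))
      (subst (λ u → Occurs u c)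
        (trans (cong (W 0 ++_) (block-++ (<⇒≤ (gap 2)) (lo 3))) (sym (++-assoc (W 0) _ _))) occ))
    b₂≡ : b 1 + d ≡ b 2
    b₂≡ = m+[n∸m]≡n (<⇒≤ (b< 1))
    tail≡ : suc (N ∸ b 2 + b 2) ≡ 2 ^ E 3
    tail≡ = trans (cong suc (m∸n+n≡m (≤pred2^ (E 3) (gap 2)))) (suc-pred-2^ (E 3))
    len₀₂ : suc (length (W 0) + (N ∸ b 2) + (b 0 + d)) ≡ 2 ^ E 3
    len₀₂ = begin
      suc (length (W 0) + (N ∸ b 2) + (b 0 + d)) ≡⟨ cong (λ l → suc (l + (N ∸ b 2) + (b 0 + d))) (length-block (b 0) (b 1)) ⟩
      suc ((b 1 ∸ b 0) + (N ∸ b 2) + (b 0 + d))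
        ≡⟨ solve 4 (λ p n x d → con 1 :+ (p :+ n :+ (x :+ d)) := con 1 :+ (n :+ (p :+ x :+ d))) refl (b 1 ∸ b 0) (N ∸ b 2) (b 0) d ⟩
      suc (N ∸ b 2 + (b 1 ∸ b 0 + b 0 + d)) ≡⟨ cong (λ l → suc (N ∸ b 2 + (l + d))) (m∸n+n≡m (<⇒≤ (b< 0))) ⟩
      suc (N ∸ b 2 + (b 1 + d)) ≡⟨ cong (λ l → suc (N ∸ b 2 + l)) b₂≡ ⟩
      suc (N ∸ b 2 + b 2) ≡⟨ tail≡ ⟩
      2 ^ E 3 ∎
    -- Hence `b 0 + d`, which is at most `b 2`, has the same binary order `E 2` as `b 2`, and both
    -- words give divisibility by the same power.
    2^≤d : 2 ^ E 2 ≤ d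
    2^≤d = 2^∣⇒≤ (E< 1) (hi 1) (subst (2 ^ E 2 ≤_) (sym b₂≡) (lo 2)) 2^∣d
    ∣₀₂ : 2 ^ E 2 ∣ length (W 0 ++ W 2)
    ∣₀₂ = W-red⇒∣ 2 (E 2) (W 0) (block-All (E 3) (<⇒≤ (b< 0)) (<-trans (b< 1) (gap 2))) len₀₂
      (≤-trans 2^≤d (m≤n+m d (b 0)))
      (≤-<-trans (subst (b 0 + d ≤_) b₂≡ (+-monoˡ-≤ d (<⇒≤ (b< 0)))) (hi 2)) red₀₂
    ∣₂ : 2 ^ E 2 ∣ length (W 2)
    ∣₂ = W-red⇒∣ 2 (E 2) [] [] tail≡ (lo 2) (hi 2) red₂
    -- Subtract the length of `W 2` from that of `W 0 ++ W 2`.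
    b₁∸b₀ : 2 ^ E 2 ∣ b 1 ∸ b 0
    b₁∸b₀ = subst (2 ^ E 2 ∣_) (length-block (b 0) (b 1))
      (∣m+n∣m⇒∣n (subst (2 ^ E 2 ∣_) (trans (length-++ (W 0)) (+-comm (length (W 0)) _)) ∣₀₂) ∣₂)
    short : b 1 ∸ b 0 < 2 ^ E 2
    short = ≤-<-trans (m∸n≤m (b 1) (b 0)) (gap 1)

  module Blue (¬red₁ : ¬ FactorRed (W 1)) (¬red₃ : ¬ FactorRed (W 3)) where

    U : List ℕ
    U = W 0 ++ W 2 ++ W 4

    N = pred (2 ^ E 3)
    P = W 0 ++ block (b 2) N
    Q = block (2 ^ E 3) (b 3) ++ W 4

    U-around : U ≡ P ++ suc (E 3) ∷ Q
    U-around = begin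
      W 0 ++ W 2 ++ W 4 ≡⟨ cong (λ l → W 0 ++ l ++ W 4) (W-around 2) ⟩
      W 0 ++ (block (b 2) N ++ suc (E 3) ∷ block (2 ^ E 3) (b 3)) ++ W 4
        ≡⟨ cong (W 0 ++_) (++-assoc (block (b 2) N) _ _) ⟩
      W 0 ++ block (b 2) N ++ suc (E 3) ∷ Q ≡⟨ ++-assoc (W 0) _ _ ⟨
      P ++ suc (E 3) ∷ Q ∎
      where open ≡-Reasoning

    -- `P` followed by the letter `suc (E 3)` is `W 0` followed by the part of `W 2` up to position
    -- `2 ^ E 3`.
    ¬occurs-left : ∀ c r → ¬ Occurs (P ++ suc (E 3) ∷ r) c
    ¬occurs-left c r occ = ¬red₁ (∣⇒W-red 1 (occurs-skip 0 c (subst (λ u → Occurs u c) eq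
      (occurs-++ˡ c (P ++ suc (E 3) ∷ []) (subst (λ u → Occurs u c) (sym (++-assoc P _ r)) occ)))))
      where
      eq : P ++ suc (E 3) ∷ [] ≡ W 0 ++ block (b 2) (2 ^ E 3)
      eq = trans (++-assoc (W 0) _ _) (cong (W 0 ++_) (sym (trans (block-around (E 3) (gap 2) ≤-refl)
        (cong (λ l → block (b 2) N ++ suc (E 3) ∷ l) (block-empty (2 ^ E 3))))))

    ¬occurs-right : ∀ c → ¬ Occurs (suc (E 3) ∷ Q) c
    -- The first block starts at index `pred (2 ^ E 3)`, so that its first letter is `suc (E 3)`
    -- itself.
    ¬occurs-right c occ = ¬red₃ (∣⇒W-red 3 (juxtaposition-congruence c (E 3) (E 5)
      (<⇒≤ (<-trans (E< 3) (E< 4))) (pred2^<2^ (E 3)) (lo 3) (<⇒≤ (b< 3)) (gap 4)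
      (occurs-++ˡ c (block N (b 3) ++ block (b 4) (2 ^ E 5)) (subst (λ u → Occurs u c) eq occ))))
      where
      open ≡-Reasoning
      eq : suc (E 3) ∷ Q ≡ (block N (b 3) ++ block (b 4) (2 ^ E 5)) ++ block (2 ^ E 5) (b 5)
      eq = begin
        suc (E 3) ∷ block (2 ^ E 3) (b 3) ++ W 4
          ≡⟨ cong (λ l → l ++ suc (E 3) ∷ block (2 ^ E 3) (b 3) ++ W 4) (block-empty N) ⟨
        block N N ++ suc (E 3) ∷ block (2 ^ E 3) (b 3) ++ W 4 ≡⟨ ++-assoc (block N N) _ _ ⟨
        (block N N ++ suc (E 3) ∷ block (2 ^ E 3) (b 3)) ++ W 4
          ≡⟨ cong₂ _++_ (sym (block-around (E 3) (pred2^<2^ (E 3)) (lo 3))) (block-++ (<⇒≤ (gap 4)) (lo 5)) ⟩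
        block N (b 3) ++ block (b 4) (2 ^ E 5) ++ block (2 ^ E 5) (b 5) ≡⟨ ++-assoc (block N (b 3)) _ _ ⟨
        (block N (b 3) ++ block (b 4) (2 ^ E 5)) ++ block (2 ^ E 5) (b 5) ∎

    U-not-factor : ¬ IsFactor U
    U-not-factor (_ , c , occ) = ¬occurs-left c Q (subst (λ u → Occurs u c) U-around occ)

    U-not-two-factors : ¬ TwoFactors U
    U-not-two-factors (x , y , (_ , c , occx) , (_ , c′ , occy) , eq)
      -- The marked letter `suc (E 3)` of `W 2` falls either in x, after all of `P`, or in y, before
      -- all of `Q`.
      with ++-split x P (trans (sym eq) U-around)
    ... | inj₁ (r , refl) = ¬occurs-left c r occx
    ... | inj₂ (r , refl) = ¬occurs-right (c′ + length r) (occurs-++ʳ c′ r occy)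

  not-monochromatic : ∀ c → HasColor (W 0 ++ W 2) c → HasColor (W 2) c → HasColor (W 1) c → HasColor (W 3) c →
    ¬ HasColor (W 0 ++ W 2 ++ W 4) c
  not-monochromatic red (inj₂ (_ , ¬two)) _ _ _ _ = ¬two (W 0 , W 2 , block-factor (b< 0) , block-factor (b< 2) , refl)
  not-monochromatic red (inj₁ _) (inj₂ (¬factor , _)) _ _ _ = ¬factor (block-factor (b< 2))
  not-monochromatic red (inj₁ (factor , red₀₂)) (inj₁ (_ , red₂)) _ _ _ = red-impossible factor red₀₂ red₂
  not-monochromatic blue _ _ (inj₂ (¬factor , _)) _ _ = ¬factor (block-factor (b< 1))
  not-monochromatic blue _ _ _ (inj₂ (¬factor , _)) _ = ¬factor (block-factor (b< 3))
  not-monochromatic blue _ _ (inj₁ (_ , ¬red₁)) (inj₁ (_ , ¬red₃)) (inj₁ (factor , _)) =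
    Blue.U-not-factor ¬red₁ ¬red₃ factor
  not-monochromatic blue _ _ (inj₁ (_ , ¬red₁)) (inj₁ (_ , ¬red₃)) (inj₂ (_ , two)) =
    Blue.U-not-two-factors ¬red₁ ¬red₃ two

-- Merging the terms of a factorisation

subProdFrom-nonempty : ∀ w i bs → subProdFrom w i bs ≢ [] → true ∈ bs
subProdFrom-nonempty w i [] ne = contradiction refl ne
subProdFrom-nonempty w i (true ∷ bs) ne = here refl
subProdFrom-nonempty w i (false ∷ bs) ne = there (subProdFrom-nonempty w (suc i) bs ne)

module Factorisation (k : ℕ) (w : ℕ → List ℕ) (fact : IsFactorisationOfSuffix k w) where

  cut : ℕ → ℕ
  cut n = k + length (prefixConcat w n)

  cut-suc : ∀ n → cut (suc n) ≡ cut n + length (w n)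
  cut-suc n = trans (cong (k +_) (length-++ (prefixConcat w n))) (sym (+-assoc k _ _))

  w-block : ∀ n → w n ≡ block (cut n) (cut (suc n))
  w-block n = trans (occurs-++ʳ k (prefixConcat w n) (proj₂ fact (suc n)))
    (cong (seg (cut n)) (sym (trans (cong (_∸ cut n) (cut-suc n)) (m+n∸m≡n (cut n) _))))

  cut< : ∀ n → cut n < cut (suc n)
  cut< n = subst (cut n <_) (sym (cut-suc n)) (m<m+n (cut n) (positive (w n) (proj₁ fact n)))
    where
    positive : ∀ (xs : List ℕ) → xs ≢ [] → 0 < length xs
    positive [] ne = contradiction refl ne
    positive (x ∷ xs) _ = s≤s z≤n

  cut-mono : ∀ {m n} → m ≤‴ n → cut m ≤ cut n
  cut-mono ≤‴-refl = ≤-refl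
  cut-mono {m} (≤‴-step p) = ≤-trans (<⇒≤ (cut< m)) (cut-mono p)

  cut-grows : ∀ n d → d + cut n ≤ cut (d + n)
  cut-grows n zero = ≤-refl
  cut-grows n (suc d) = ≤-<-trans (cut-grows n d) (cut< (d + n))

  -- Words obtained by selecting terms from `w i` onwards. The order `≤‴` used with it steps at its
  -- lower end, just as `subProdFrom` advances its start index.
  Selected : ℕ → List ℕ → Set
  Selected i u = ∃ λ bs → subProdFrom w i bs ≡ u

  selected-[] : ∀ {i} → Selected i []
  selected-[] = [] , refl

  skip : ∀ {i j u} → i ≤‴ j → Selected j u → Selected i u
  skip ≤‴-refl s = s
  skip (≤‴-step p) s with skip p s
  ... | bs , eq = false ∷ bs , eq

  take : ∀ {i j u} → i ≤‴ j → Selected j u → Selected i (block (cut i) (cut j) ++ u)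
  take {i} {u = u} ≤‴-refl s = subst (λ l → Selected i (l ++ u)) (sym (block-empty (cut i))) s
  take {i} {j} {u} (≤‴-step p) s with take p s
  ... | bs , eq = true ∷ bs , (begin
    w i ++ subProdFrom w (suc i) bs ≡⟨ cong₂ _++_ (w-block i) eq ⟩
    block (cut i) (cut (suc i)) ++ block (cut (suc i)) (cut j) ++ u ≡⟨ ++-assoc (block (cut i) (cut (suc i))) _ _ ⟨
    (block (cut i) (cut (suc i)) ++ block (cut (suc i)) (cut j)) ++ u
      ≡⟨ cong (_++ u) (sym (block-++ (<⇒≤ (cut< i)) (cut-mono p))) ⟩
    block (cut i) (cut j) ++ u ∎)
    where open ≡-Reasoning

  -- Each step at least doubles the cut position, so that a power of two is passed.
  index : ℕ → ℕ
  index zero    = 1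
  index (suc i) = cut (index i) + index i

  order : ∀ i → ∃ λ e → 2 ^ e ≤ cut (index i) × cut (index i) < 2 ^ suc e
  order i = binary-order (cut (index i)) (positive i)
    where
    positive : ∀ i → 1 ≤ cut (index i)
    -- As `index` starts at 1, one nonempty term precedes the first cut, which is thus positive even
    -- for k = 0.
    positive zero = ≤-<-trans z≤n (cut< 0)
    positive (suc i) = ≤-trans (positive i) (≤-trans (m≤m+n _ _) (cut-grows (index i) (cut (index i))))

  gap : ∀ i → cut (index i) < 2 ^ proj₁ (order (suc i))
  -- Twice the old cut is at most the new cut, which is below `2 ^ suc e` for its order e; halve
  -- both sides.
  gap i = *-cancelˡ-< 2 _ _ (≤-<-trans
    (subst (_≤ cut (index (suc i))) (cong (cut (index i) +_) (sym (+-identityʳ _))) (cut-grows (index i) (cut (index i))))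
    (proj₂ (proj₂ (order (suc i)))))

  open SparseCuts (cut ∘ index) (proj₁ ∘ order) (proj₁ ∘ proj₂ ∘ order) (proj₂ ∘ proj₂ ∘ order) gap

  index≤ : ∀ i → index i ≤‴ index (suc i)
  index≤ i = ≤⇒≤‴ (m≤n+m (index i) (cut (index i)))

  take-W : ∀ i {u} → Selected (index (suc i)) u → Selected (index i) (W i ++ u)
  take-W i = take (index≤ i)

  last-W : ∀ i → Selected (index i) (W i)
  last-W i = subst (Selected (index i)) (++-identityʳ (W i)) (take-W i selected-[])

  skip-all : ∀ i {u} → Selected (index i) u → Selected 0 u
  skip-all i = skip (≤⇒≤‴ z≤n)

  ¬super-monochromatic : ¬ SuperMonochromatic w
  ¬super-monochromatic (c , mono) = not-monochromatic c
    (color (W≢[] 0) (skip-all 0 (take-W 0 (skip (index≤ 1) (last-W 2)))))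
    (color-W 2) (color-W 1) (color-W 3)
    (color (W≢[] 0) (skip-all 0 (take-W 0 (skip (index≤ 1) (take-W 2 (skip (index≤ 3) (last-W 4)))))))
    where
    color : ∀ {u} → u ≢ [] → Selected 0 u → HasColor u c
    color ne (bs , refl) = mono bs (subProdFrom-nonempty w 0 bs ne)
    W≢[] : ∀ i {u} → W i ++ u ≢ []
    W≢[] i eq = block-nonempty (b< i) (++-conicalˡ (W i) _ eq)
    color-W : ∀ i → HasColor (W i) c
    color-W i = color (block-nonempty (b< i)) (skip-all i (last-W i))

theorem3 : (k : ℕ) (w : ℕ → List ℕ) → ¬ (IsFactorisationOfSuffix k w × SuperMonochromatic w)
theorem3 k w (fact , mono) = Factorisation.¬super-monochromatic k w fact mono
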